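{- Let $T$ be a tournament on $n$ vertices. If $n$ is odd, there is a set of $n$ dice $X_1,\dots,X_n$, each with $n$ sides, that realizes $T$. If $n$ is divisible by $4$, there is a set of $n$ dice $X_1,\dots,X_n$, each with $n+1$ sides, that realizes $T$. If $n$ is even and not divisible by $4$, there is a set of $n$ dice $X_1,\dots,X_n$, each with $n-1$ sides, that realizes $T$.
   Context: A tournament on $n$ vertices is a directed graph on the vertex set $\{1,2,\dots,n\}$ such that for every pair of distinct vertices $i,j$ there is either an edge from $i$ to $j$ or an edge from $j$ to $i$, but not both (and there are no loops). A die with $k$ sides is a list of $k$ numbers (its faces); rolling it yields each of its $k$ faces with probability $1/k$, and different dice are rolled independently. Thus for two $k$-sided dice $X$ and $X'$, the probability that $X$ rolls a higher number than $X'$ is the number of ordered pairs ($a$ a face of $X$, $b$ a face of $X'$) with $a>b$, divided by $k^2$. Write $X_i \succeq X_j$ if the probability that $X_i$ rolls a higher number than $X_j$ is greater than $1/2$. A set of dice $X_1,\dots,X_n$ realizes a tournament $T$ on $\{1,\dots,n\}$ if for all distinct $i,j$: $X_i \succeq X_j$ if and only if there is an edge from $i$ to $j$ in $T$. -}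

module Defs where

open import Data.Fin.Base using (Fin)
open import Data.Integer.Base using (+_)
open import Data.Nat.Base using (ℕ; NonZero; _*_)
open import Data.Nat.Properties using (_<?_; m*n≢0)
open import Data.Product.Base using (Σ-syntax; proj₁; proj₂)
open import Data.Rational.Base using (ℚ; _/_; _<_; ½)
open import Data.Sum.Base using (_⊎_)
open import Data.Vec.Base using (Vec; allPairs; count)
open import Function.Bundles using (_⇔_)
open import Level using (0ℓ)
open import Relation.Binary.Core using (Rel)
open import Relation.Binary.Definitions using (Irreflexive; Asymmetric)
open import Relation.Binary.PropositionalEquality.Core using (_≡_; _≢_)

-- The vertices 1, …, n are represented by the elements of Fin n.
record Tournament (n : ℕ) : Set₁ where
  field
    Edge   : Rel (Fin n) 0ℓ
    irrefl : Irreflexive _≡_ Edge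
    asym   : Asymmetric Edge
    total  : ∀ {i j} → i ≢ j → Edge i j ⊎ Edge j i

-- Faces are natural numbers. Only their relative order matters, so any finite
-- family of dice with real faces can be relabelled to have faces in ℕ.
Die : ℕ → Set
Die k = Vec ℕ k

wins : ∀ {k} → Die k → Die k → ℕ
wins X Y = count (λ p → proj₂ p <? proj₁ p) (allPairs X Y)

winProbability : ∀ {k} .{{_ : NonZero k}} → Die k → Die k → ℚ
winProbability {k} X Y = _/_ (+ wins X Y) (k * k) {{m*n≢0 k k}}

infix 4 _≽_

_≽_ : ∀ {k} .{{_ : NonZero k}} → Rel (Die k) 0ℓ
X ≽ Y = ½ < winProbability X Y

Realizes : ∀ {n k} .{{_ : NonZero k}} → (Fin n → Die k) → Tournament n → Set
Realizes X T = ∀ i j → i ≢ j → X i ≽ X j ⇔ Tournament.Edge T i j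

-- The number of sides must be positive for the probabilities to make sense.
RealizableWithSides : ∀ {n} → Tournament n → ℕ → Set
RealizableWithSides {n} T k =
  Σ[ k≢0 ∈ NonZero k ] Σ[ X ∈ (Fin n → Die k) ] Realizes {{k≢0}} X T

{-# OPTIONS --safe #-}

-- Let k be odd and split the faces into k blocks, every die having one face in
-- each block.  Comparisons between different blocks cancel, so X_i beats X_j
-- exactly when it lies above X_j inside a majority of the blocks.
--
-- For n = k, order block m by the cyclic distance of i from m in ℤ/k.  The
-- reflection m ↦ i + j - m exchanges the two distances, so the blocks balance
-- except for the one at (i + j)/2, where i and j tie.  At most two dice tie at
-- a given height of a block, so T can be used to break each tie freely.
--
-- For n = k + 1 and k = 1 + 4q, let an extra die tie with die m in block m,
-- at a height separating the distances 1, …, q from q + 1, …, 2q.  The exchange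
-- d ↦ 2q + 1 - d of distances then balances the extra die against any other one.
-- For 4 ∣ n, omit one die from the construction for n + 1.
module Submission where

open import Defs
open import Data.Nat.Base using (ℕ; _+_; _∸_)
open import Data.Nat.Divisibility using (_∣_)
open import Data.Product.Base using (_×_)
open import Relation.Nullary.Negation.Core using (¬_)

import Algebra.Properties.CommutativeMonoid.Sum
open import Data.Bool.Base using (true; false; if_then_else_)
open import Data.Fin.Base as Fin using (Fin; zero; suc; toℕ; fromℕ<)
open import Data.Fin.Permutation using (Permutation′; permutation; _⟨$⟩ʳ_)
import Data.Fin.Properties as Fin
import Data.Integer.Base as ℤ
open ℤ using (ℤ; ∣_∣; 0ℤ)
import Data.Integer.DivMod as ℤ
import Data.Integer.Properties as ℤ
open import Data.Integer.Tactic.RingSolver using (solve-∀)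
open import Data.Nat.Base hiding (∣_-_∣; parity)
open import Data.Nat.Divisibility using (divides)
open import Data.Nat.Properties
open import Data.Product.Base using (Σ-syntax; ∃-syntax; _,_; proj₁; proj₂)
import Data.Rational.Base as ℚ
import Data.Rational.Properties as ℚ
import Data.Rational.Unnormalised.Base as ℚᵘ
import Data.Rational.Unnormalised.Properties as ℚᵘ
open import Data.Sum.Base using (_⊎_; inj₁; inj₂)
open import Data.Vec.Base using (Vec; []; _∷_; _++_; map; allPairs; count; tabulate)
open import Function.Base using (_∘_; _$_; case_of_)
open import Function.Bundles using (_⇔_; mk⇔; Equivalence)
open import Relation.Binary.Definitions using (tri<; tri≈; tri>)
open import Relation.Binary.PropositionalEquality
open import Relation.Nullary using (Dec; yes; no; does; contradiction)
open import Relation.Nullary.Decidable using (_×-dec_)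
open import Relation.Unary using (Pred; Decidable)

module S = Algebra.Properties.CommutativeMonoid.Sum +-0-commutativeMonoid
open S using (sum)

-- Indicators and finite sums.

𝟙 : ∀ {a} {A : Set a} → Dec A → ℕ
𝟙 A? = if does A? then 1 else 0

𝟙-true : ∀ {a} {A : Set a} (A? : Dec A) → A → 𝟙 A? ≡ 1
𝟙-true (yes _) _ = refl
𝟙-true (no ¬a) a = contradiction a ¬a

𝟙-false : ∀ {a} {A : Set a} (A? : Dec A) → ¬ A → 𝟙 A? ≡ 0
𝟙-false (yes a) ¬a = contradiction a ¬a
𝟙-false (no _)  _  = refl

𝟙<2 : ∀ {a} {A : Set a} (A? : Dec A) → 𝟙 A? < 2
𝟙<2 (yes _) = s≤s (s≤s z≤n)
𝟙<2 (no _)  = s≤s z≤n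

𝟙-mono : ∀ {a b} {A : Set a} {B : Set b} (A? : Dec A) (B? : Dec B) → (A → B) → 𝟙 A? ≤ 𝟙 B?
𝟙-mono (no _)  _  _ = z≤n
𝟙-mono (yes a) B? f = ≤-reflexive (sym (𝟙-true B? (f a)))

𝟙-cong : ∀ {a b} {A : Set a} {B : Set b} (A? : Dec A) (B? : Dec B) → (A → B) → (B → A) → 𝟙 A? ≡ 𝟙 B?
𝟙-cong A? B? f g = ≤-antisym (𝟙-mono A? B? f) (𝟙-mono B? A? g)

𝟙-<-total : ∀ {x y} → x ≢ y → 𝟙 (y <? x) + 𝟙 (x <? y) ≡ 1
𝟙-<-total {x} {y} x≢y with <-cmp x y
... | tri< x<y _ y≮x = cong₂ _+_ (𝟙-false (y <? x) y≮x) (𝟙-true (x <? y) x<y)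
... | tri≈ _ x≡y _   = contradiction x≡y x≢y
... | tri> x≮y _ y<x = cong₂ _+_ (𝟙-true (y <? x) y<x) (𝟙-false (x <? y) x≮y)

sum-mono-≤ : ∀ {n} {f g : Fin n → ℕ} → (∀ x → f x ≤ g x) → sum f ≤ sum g
sum-mono-≤ {zero}  f≤g = z≤n
sum-mono-≤ {suc n} f≤g = +-mono-≤ (f≤g zero) (sum-mono-≤ (f≤g ∘ suc))

sum-mono-< : ∀ {n} {f g : Fin n → ℕ} → (∀ x → f x ≤ g x) → ∀ x → f x < g x → sum f < sum g
sum-mono-< f≤g zero    f<g = +-mono-<-≤ f<g (sum-mono-≤ (f≤g ∘ suc))
sum-mono-< f≤g (suc x) f<g = +-mono-≤-< (f≤g zero) (sum-mono-< (f≤g ∘ suc) x f<g)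

-- Only the terms at `x` can differ; adding each to the other side avoids subtraction in `ℕ`.
sum-agree : ∀ {n} (f g : Fin n → ℕ) x → (∀ y → y ≢ x → f y ≡ g y) → sum f + g x ≡ sum g + f x
sum-agree f g zero f≡g = begin
  f zero + sum (f ∘ suc) + g zero ≡⟨ cong (λ t → f zero + t + g zero) (S.sum-cong-≗ (λ y → f≡g (suc y) λ ())) ⟩
  f zero + sum (g ∘ suc) + g zero ≡⟨ +-comm _ (g zero) ⟩
  g zero + (f zero + sum (g ∘ suc)) ≡⟨ cong (g zero +_) (+-comm (f zero) _) ⟩
  g zero + (sum (g ∘ suc) + f zero) ≡⟨ +-assoc (g zero) _ _ ⟨
  g zero + sum (g ∘ suc) + f zero ∎
  where open ≡-Reasoning
sum-agree f g (suc x) f≡g = begin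
  f zero + sum (f ∘ suc) + g (suc x)   ≡⟨ +-assoc (f zero) _ _ ⟩
  f zero + (sum (f ∘ suc) + g (suc x)) ≡⟨ cong₂ _+_ (f≡g zero λ ())
    (sum-agree (f ∘ suc) (g ∘ suc) x (λ y y≢x → f≡g (suc y) (y≢x ∘ Fin.suc-injective))) ⟩
  g zero + (sum (g ∘ suc) + f (suc x)) ≡⟨ +-assoc (g zero) _ _ ⟨
  g zero + sum (g ∘ suc) + f (suc x)   ∎
  where open ≡-Reasoning

sum-const : ∀ {n} {f : Fin n → ℕ} c → (∀ x → f x ≡ c) → sum f ≡ n * c
sum-const {zero}  c f≡c = refl
sum-const {suc n} c f≡c = cong₂ _+_ (f≡c zero) (sum-const c (f≡c ∘ suc))

-- Win counts as double sums, and the threshold one half.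

module _ {a p} {A : Set a} {P : Pred A p} (P? : Decidable P) where

  count-∷ : ∀ {n} x (xs : Vec A n) → count P? (x ∷ xs) ≡ 𝟙 (P? x) + count P? xs
  count-∷ x xs with does (P? x)
  ... | true  = refl
  ... | false = refl

  count-++ : ∀ {m n} (xs : Vec A m) (ys : Vec A n) → count P? (xs ++ ys) ≡ count P? xs + count P? ys
  count-++ []       ys = refl
  count-++ (x ∷ xs) ys with does (P? x)
  ... | true  = cong suc (count-++ xs ys)
  ... | false = count-++ xs ys

count-map-tabulate : ∀ {a b p} {A : Set a} {B : Set b} {P : Pred B p} (P? : Decidable P)
  (f : A → B) {n} (g : Fin n → A) →
  count P? (map f (tabulate g)) ≡ sum (λ x → 𝟙 (P? (f (g x))))
count-map-tabulate P? f {zero}  g = refl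
count-map-tabulate P? f {suc n} g =
  trans (count-∷ P? (f (g zero)) (map f (tabulate (g ∘ suc))))
    (cong (𝟙 (P? (f (g zero))) +_) (count-map-tabulate P? f (g ∘ suc)))

wins-tabulate : ∀ {k} (f g : Fin k → ℕ) →
  wins (tabulate f) (tabulate g) ≡ sum (λ x → sum (λ y → 𝟙 (g y <? f x)))
wins-tabulate f g = go f
  where
  won? : (p : ℕ × ℕ) → Dec (proj₂ p < proj₁ p)
  won? p = proj₂ p <? proj₁ p
  -- `allPairs` recurses on its first vector only, so the length of `f` must vary while `g` stays
  -- fixed.
  go : ∀ {l} (f : Fin l → ℕ) →
    count won? (allPairs (tabulate f) (tabulate g)) ≡ sum (λ x → sum (λ y → 𝟙 (g y <? f x)))
  go {zero}  f = refl
  go {suc l} f = trans (count-++ won? (map (f zero ,_) (tabulate g)) _)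
    (cong₂ _+_ (count-map-tabulate won? (f zero ,_) g) (go (f ∘ suc)))

-- Without ties each pair of faces is won by exactly one die; exchanging the sums in the second
-- count lines the pairs up.
wins-complement : ∀ {k} (f g : Fin k → ℕ) → (∀ x y → f x ≢ g y) →
  wins (tabulate f) (tabulate g) + wins (tabulate g) (tabulate f) ≡ k * k
wins-complement {k} f g f≢g = begin
  wins (tabulate f) (tabulate g) + wins (tabulate g) (tabulate f)
    ≡⟨ cong₂ _+_ (wins-tabulate f g) (trans (wins-tabulate g f) (S.∑-comm (λ y x → 𝟙 (f x <? g y)))) ⟩
  sum (λ x → sum (λ y → 𝟙 (g y <? f x))) + sum (λ x → sum (λ y → 𝟙 (f x <? g y)))
    ≡⟨ S.∑-distrib-+ (λ x → sum (λ y → 𝟙 (g y <? f x))) _ ⟨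
  sum (λ x → sum (λ y → 𝟙 (g y <? f x)) + sum (λ y → 𝟙 (f x <? g y)))
    ≡⟨ sum-const k (λ x → trans (sym (S.∑-distrib-+ (λ y → 𝟙 (g y <? f x)) _))
         (trans (sum-const 1 (λ y → 𝟙-<-total (f≢g x y))) (*-identityʳ k))) ⟩
  k * k ∎
  where open ≡-Reasoning

-- Cross-multiplication, done on unnormalised rationals because `_/_` reduces to lowest terms.
½</⇔ : ∀ w K .{{_ : NonZero K}} → ℚ.½ ℚ.< ℤ.+ w ℚ./ K ⇔ K < w + w
½</⇔ w (suc d) = mk⇔ to from
  where
  K = suc d
  p : ℚᵘ.ℚᵘ
  p = ℚᵘ.mkℚᵘ (ℤ.+ w) d
  eq : (ℤ.+ w ℤ.* ℤ.+ 2) ≡ ℤ.+ (w + w)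
  eq = trans (sym (ℤ.pos-* w 2)) (cong ℤ.+_ (trans (*-comm w 2) (cong (w +_) (+-identityʳ w))))
  eq′ : (ℤ.+ 1 ℤ.* ℤ.+ K) ≡ ℤ.+ K
  eq′ = ℤ.*-identityˡ (ℤ.+ K)
  to : ℚ.½ ℚ.< ℤ.+ w ℚ./ K → K < w + w
  to lt = ℤ.drop‿+<+ (subst₂ ℤ._<_ eq′ eq
    (ℚᵘ.drop-*<* (ℚᵘ.<-respʳ-≃ (ℚ.toℚᵘ-fromℚᵘ p) (ℚ.toℚᵘ-mono-< lt))))
  from : K < w + w → ℚ.½ ℚ.< ℤ.+ w ℚ./ K
  from lt = ℚ.toℚᵘ-cancel-< (ℚᵘ.<-respʳ-≃ (ℚᵘ.≃-sym (ℚ.toℚᵘ-fromℚᵘ p))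
    (ℚᵘ.*<* (subst₂ ℤ._<_ (sym eq′) (sym eq) (ℤ.+<+ lt))))

-- The two win counts add up to `k * k`, so exceeding half of it means exceeding the other count.
≽⇔wins< : ∀ {k} .{{_ : NonZero k}} (f g : Fin k → ℕ) → (∀ x y → f x ≢ g y) →
  tabulate f ≽ tabulate g ⇔ wins (tabulate g) (tabulate f) < wins (tabulate f) (tabulate g)
≽⇔wins< {k} f g f≢g = mk⇔
  (λ lt → +-cancelˡ-< w _ _ (subst (_< w + w) (sym total) (to lt)))
  (λ lt → from (subst (_< w + w) total (+-monoʳ-< w lt)))
  where
  w = wins (tabulate f) (tabulate g)
  total = wins-complement f g f≢g
  open Equivalence (½</⇔ w (k * k) {{m*n≢0 k k}}) using (to; from)


-- Dice whose faces are split into blocks.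

module Layered {k n : ℕ} (B : ℕ) (e : Fin k → Fin n → ℕ) (e<B : ∀ m i → e m i < B) where

  -- A two-digit number in base `B` with the block as leading digit, so that heights matter only
  -- inside one block.
  face : Fin n → Fin k → ℕ
  face i m = toℕ m * B + e m i

  die : Fin n → Die k
  die i = tabulate (face i)

  beats : Fin n → Fin n → Fin k → ℕ
  beats i j m = 𝟙 (e m j <? e m i)

  face-mono-< : ∀ {m m′} i j → m Fin.< m′ → face i m < face j m′
  face-mono-< {m} {m′} i j m<m′ = begin-strict
    toℕ m * B + e m i   <⟨ +-monoʳ-< (toℕ m * B) (e<B m i) ⟩
    toℕ m * B + B       ≡⟨ +-comm _ B ⟩
    suc (toℕ m) * B     ≤⟨ *-monoˡ-≤ B m<m′ ⟩
    toℕ m′ * B          ≤⟨ m≤m+n _ _ ⟩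
    face j m′           ∎
    where open ≤-Reasoning

  𝟙-face-< : ∀ {m m′} i j → m′ ≢ m → 𝟙 (face j m′ <? face i m) ≡ 𝟙 (m′ Fin.<? m)
  𝟙-face-< {m} {m′} i j m′≢m = 𝟙-cong (face j m′ <? face i m) (m′ Fin.<? m)
    (λ lt → case Fin.<-cmp m′ m of λ where
      (tri< m′<m _ _) → m′<m
      (tri≈ _ m′≡m _) → contradiction m′≡m m′≢m
      (tri> _ _ m<m′) → contradiction lt (<-asym (face-mono-< i j m<m′)))
    (face-mono-< j i)

  face-distinct : ∀ {i j} → (∀ m → e m i ≢ e m j) → ∀ m m′ → face i m ≢ face j m′
  face-distinct {i} {j} e≢ m m′ eq with Fin.<-cmp m m′
  ... | tri< m<m′ _ _ = <⇒≢ (face-mono-< i j m<m′) eq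
  ... | tri≈ _ refl _ = e≢ m (+-cancelˡ-≡ (toℕ m * B) _ _ eq)
  ... | tri> _ _ m′<m = <⇒≢ (face-mono-< j i m′<m) (sym eq)

  lowerBlocks : Fin k → ℕ
  lowerBlocks m = sum {k} (λ m′ → 𝟙 (m′ Fin.<? m))

  -- Comparisons across blocks contribute `sum lowerBlocks` for any two dice, so only the second
  -- summand depends on the pair.
  wins-die : ∀ i j → wins (die i) (die j) ≡ sum lowerBlocks + sum (beats i j)
  wins-die i j = trans (wins-tabulate (face i) (face j))
    (trans (S.sum-cong-≗ row) (S.∑-distrib-+ lowerBlocks (beats i j)))
    where
    row : ∀ m → sum (λ m′ → 𝟙 (face j m′ <? face i m)) ≡ lowerBlocks m + beats i j m
    row m = begin
      -- Off the diagonal only the blocks count. As `g m` is `0`, `sum-agree` turns `sum f` into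
      -- `sum g` plus the diagonal term `f m`.
      sum f               ≡⟨ +-identityʳ _ ⟨
      sum f + 0           ≡⟨ cong (sum f +_) (𝟙-false (m Fin.<? m) (<-irrefl refl)) ⟨
      sum f + g m         ≡⟨ sum-agree f g m (λ m′ → 𝟙-face-< i j) ⟩
      sum g + f m         ≡⟨ cong (sum g +_) (𝟙-cong (face j m <? face i m) (e m j <? e m i)
                               (+-cancelˡ-< (toℕ m * B) _ _) (+-monoʳ-< (toℕ m * B))) ⟩
      sum g + beats i j m ∎
      where
      open ≡-Reasoning
      f g : Fin k → ℕ
      f m′ = 𝟙 (face j m′ <? face i m)
      g m′ = 𝟙 (m′ Fin.<? m)

  wins-< : ∀ {i j} → sum (beats i j) < sum (beats j i) → wins (die i) (die j) < wins (die j) (die i)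
  wins-< {i} {j} lt = subst₂ _<_ (sym (wins-die i j)) (sym (wins-die j i)) (+-monoʳ-< (sum lowerBlocks) lt)

-- Balanced layouts.

-- The sum condition says that σ reverses the comparison of i and j, and it is
-- symmetric in i and j.
Balanced : ∀ {k n} → (Fin k → Fin n → ℕ) → Fin n → Fin n → Set
Balanced {k} rank i j = Σ[ σ ∈ Permutation′ k ]
  (∀ m → rank (σ ⟨$⟩ʳ m) i + rank m i ≡ rank (σ ⟨$⟩ʳ m) j + rank m j) ×
  (∃[ m ] rank m i ≡ rank m j)

Balanced-sym : ∀ {k n} (rank : Fin k → Fin n → ℕ) {i j} → Balanced rank i j → Balanced rank j i
Balanced-sym rank (σ , sums , m , tie) = σ , sym ∘ sums , m , sym tie

-- In block m die i stands at height ∣ pos m i ∣; the sign of the position tells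
-- apart the at most two dice that share a height.
record Layout (k n : ℕ) : Set where
  field
    pos     : Fin k → Fin n → ℤ.ℤ
    pos-inj : ∀ m {i j} → pos m i ≡ pos m j → i ≡ j
    bound   : ℕ

  rank : Fin k → Fin n → ℕ
  rank m i = ℤ.∣ pos m i ∣

  field
    rank≤bound : ∀ m i → rank m i ≤ bound
    balanced   : ∀ {i j} → i ≢ j → Balanced rank i j

-- Each condition involves at most two dice, so it passes to any subset of them.
restrict : ∀ {k n n′} (f : Fin n′ → Fin n) → (∀ {i j} → f i ≡ f j → i ≡ j) → Layout k n → Layout k n′
restrict f f-inj L = record
  { pos        = λ m i → pos m (f i)
  ; pos-inj    = λ m eq → f-inj (pos-inj m eq)
  ; bound      = bound
  ; rank≤bound = λ m i → rank≤bound m (f i)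
  ; balanced   = λ i≢j → balanced (i≢j ∘ f-inj)
  }
  where open Layout L

-- From a layout to dice realizing a tournament.

∣i∣≡∣j∣⇒i≡±j : ∀ i j → ℤ.∣ i ∣ ≡ ℤ.∣ j ∣ → i ≡ j ⊎ i ≡ ℤ.- j
∣i∣≡∣j∣⇒i≡±j (ℤ.+ m)      (ℤ.+ n)      refl = inj₁ refl
∣i∣≡∣j∣⇒i≡±j (ℤ.+ m)      (ℤ.-[1+ n ]) refl = inj₂ refl
∣i∣≡∣j∣⇒i≡±j (ℤ.-[1+ m ]) (ℤ.+ n)      refl = inj₂ refl
∣i∣≡∣j∣⇒i≡±j (ℤ.-[1+ m ]) (ℤ.-[1+ n ]) refl = inj₁ refl

module _ {n} (T : Tournament n) where
  open Tournament T

  -- Decidability comes from `total`, with `asym` and `irrefl` refuting the remaining cases;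
  -- breaking ties needs it.
  edge? : ∀ i j → Dec (Edge i j)
  edge? i j with i Fin.≟ j
  ... | yes i≡j = no (irrefl i≡j)
  ... | no i≢j with total i≢j
  ...   | inj₁ i→j = yes i→j
  ...   | inj₂ j→i = no (asym j→i)

  -- One direction suffices: if `i` beat `j` without an edge, the opposite edge would make `j` beat
  -- `i`.
  realizes : ∀ {k} .{{_ : NonZero k}} (X : Fin n → Die k) →
    (∀ {i j} → i ≢ j → X i ≽ X j ⇔ wins (X j) (X i) < wins (X i) (X j)) →
    (∀ {i j} → Edge i j → wins (X j) (X i) < wins (X i) (X j)) → Realizes X T
  realizes X ≽⇔ edge⇒ i j i≢j = mk⇔
    (λ Xi≽Xj → case total i≢j of λ where
      (inj₁ i→j) → i→j
      (inj₂ j→i) → contradiction (to Xi≽Xj) (<-asym (edge⇒ j→i)))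
    (from ∘ edge⇒)
    where open Equivalence (≽⇔ i≢j) using (to; from)

  module _ {l} (L : Layout (suc l) n) where
    open Layout L

    private
      k = suc l

    -- Distinct dice of equal rank have opposite positions, and two sign changes lead back to the
    -- start.
    rank-tie : ∀ m {i j l} → rank m i ≡ rank m j → rank m j ≡ rank m l → i ≢ j → j ≢ l → i ≡ l
    rank-tie m {i} {j} {l} ij jl i≢j j≢l
      with ∣i∣≡∣j∣⇒i≡±j (pos m i) (pos m j) ij | ∣i∣≡∣j∣⇒i≡±j (pos m j) (pos m l) jl
    ... | inj₁ eq | _        = contradiction (pos-inj m eq) i≢j
    ... | inj₂ _  | inj₁ eq  = contradiction (pos-inj m eq) j≢l
    ... | inj₂ p  | inj₂ q   = pos-inj m
      (trans p (trans (cong ℤ.-_ q) (ℤ.neg-involutive (pos m l))))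

    tieWin? : ∀ m i → Dec (∃[ j ] rank m i ≡ rank m j × Edge i j)
    tieWin? m i = Fin.any? λ j → (rank m i ≟ rank m j) ×-dec edge? i j

    -- Doubling the rank leaves a free slot above it for the winner of a tie.
    height : Fin k → Fin n → ℕ
    height m i = rank m i * 2 + 𝟙 (tieWin? m i)

    height-< : ∀ {m i m′ j} → rank m i < rank m′ j → height m i < height m′ j
    height-< {m} {i} {m′} {j} lt = begin-strict
      height m i        <⟨ +-monoʳ-< (rank m i * 2) (𝟙<2 (tieWin? m i)) ⟩
      rank m i * 2 + 2  ≡⟨ +-comm _ 2 ⟩
      suc (rank m i) * 2 ≤⟨ *-monoˡ-≤ 2 lt ⟩
      rank m′ j * 2     ≤⟨ m≤m+n _ _ ⟩
      height m′ j       ∎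
      where open ≤-Reasoning

    height-tie : ∀ {m i j} → rank m i ≡ rank m j → Edge i j → height m j < height m i
    height-tie {m} {i} {j} eq i→j = begin-strict
      -- By `rank-tie` the only die other than `j` tied with `j` is `i`, to which `j` loses, so `j`
      -- gets no bonus.
      rank m j * 2 + 𝟙 (tieWin? m j) ≡⟨ cong (_ +_) (𝟙-false (tieWin? m j) λ (l , eq′ , j→l) →
        asym i→j (subst (Edge j) (sym (rank-tie m eq eq′ (λ i≡j → irrefl i≡j i→j) (λ j≡l → irrefl j≡l j→l))) j→l)) ⟩
      rank m j * 2 + 0 <⟨ +-monoʳ-< (rank m j * 2) (s≤s z≤n) ⟩
      rank m j * 2 + 1 ≡⟨ cong₂ (λ r b → r * 2 + b) (sym eq) (sym (𝟙-true (tieWin? m i) (j , eq , i→j))) ⟩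
      height m i ∎
      where open ≤-Reasoning

    height≢ : ∀ {i j} → i ≢ j → ∀ m → height m i ≢ height m j
    height≢ {i} {j} i≢j m with <-cmp (rank m i) (rank m j) | total i≢j
    ... | tri< lt _ _ | _        = <⇒≢ (height-< {m} {i} {m} {j} lt)
    ... | tri≈ _ eq _ | inj₁ i→j = <⇒≢ (height-tie eq i→j) ∘ sym
    ... | tri≈ _ eq _ | inj₂ j→i = <⇒≢ (height-tie (sym eq) j→i)
    ... | tri> _ _ gt | _        = <⇒≢ (height-< {m} {j} {m} {i} gt) ∘ sym

    private
      -- Ranks run from `0` to `bound`, with two heights each.
      B = suc bound * 2

    height<B : ∀ m i → height m i < B
    height<B m i = begin-strict
      height m i         <⟨ +-monoʳ-< (rank m i * 2) (𝟙<2 (tieWin? m i)) ⟩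
      rank m i * 2 + 2   ≡⟨ +-comm _ 2 ⟩
      suc (rank m i) * 2 ≤⟨ *-monoˡ-≤ 2 (s≤s (rank≤bound m i)) ⟩
      B                  ∎
      where open ≤-Reasoning

    open Layered B height height<B

    -- `σ` carries the blocks won by `j` to blocks won by `i`. As `T` settles every tie for `i`, a
    -- tied block makes the inequality strict.
    beats-< : ∀ {i j} → Edge i j → sum (beats j i) < sum (beats i j)
    beats-< {i} {j} i→j with balanced (λ i≡j → irrefl i≡j i→j)
    ... | σ , sums , m₀ , tie = subst (sum (beats j i) <_) (sym (S.sum-permute (beats i j) σ))
      (sum-mono-< step m₀ strict)
      where
      flip-< : ∀ m → rank m i < rank m j → rank (σ ⟨$⟩ʳ m) j < rank (σ ⟨$⟩ʳ m) i
      flip-< m lt = ≰⇒> λ le → <⇒≢ (+-mono-≤-< le lt) (sums m)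

      flip-≡ : ∀ m → rank m i ≡ rank m j → rank (σ ⟨$⟩ʳ m) i ≡ rank (σ ⟨$⟩ʳ m) j
      flip-≡ m eq = +-cancelʳ-≡ (rank m i) _ _ (trans (sums m) (cong (rank (σ ⟨$⟩ʳ m) j +_) (sym eq)))

      step : ∀ m → beats j i m ≤ beats i j (σ ⟨$⟩ʳ m)
      -- If `j` is above `i` in block `m`, it is so by rank, since a tie would have gone to `i`.
      step m = 𝟙-mono (height m i <? height m j) (_ <? _) λ lt →
        case <-cmp (rank m i) (rank m j) of λ where
          (tri< r< _ _) → height-< {σ ⟨$⟩ʳ m} {j} {σ ⟨$⟩ʳ m} {i} (flip-< m r<)
          (tri≈ _ r≡ _) → contradiction (height-tie r≡ i→j) (<-asym lt)
          (tri> _ _ r>) → contradiction (height-< {m} {j} {m} {i} r>) (<-asym lt)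

      strict : beats j i m₀ < beats i j (σ ⟨$⟩ʳ m₀)
      -- The tie in `m₀` makes `σ m₀` a tie too, and `i` wins both.
      strict = subst₂ _<_
        (sym (𝟙-false (height m₀ i <? height m₀ j) (<-asym (height-tie tie i→j))))
        (sym (𝟙-true (height (σ ⟨$⟩ʳ m₀) j <? height (σ ⟨$⟩ʳ m₀) i) (height-tie (flip-≡ m₀ tie) i→j)))
        (s≤s z≤n)

    layout⇒realizable : RealizableWithSides T k
    layout⇒realizable = _ , die , realizes die
      (λ {i} {j} i≢j → ≽⇔wins< (face i) (face j) (face-distinct (height≢ i≢j)))
      (λ i→j → wins-< (beats-< i→j))

-- Arithmetic modulo an odd number.

involution⇒permutation : ∀ {n} (f : Fin n → Fin n) → (∀ x → f (f x) ≡ x) → Permutation′ n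
involution⇒permutation f f∘f = permutation f f f∘f f∘f

i-[i-m]≡m : ∀ i m → i ℤ.- (i ℤ.- m) ≡ m
i-[i-m]≡m = solve-∀

module Cyclic (h : ℕ) where

  N : ℕ
  N = suc (2 * h)

  infix 4 _≈_
  -- Congruence modulo `N`; carrying the quotient turns the closure properties below into ring
  -- identities.
  record _≈_ (z w : ℤ) : Set where
    constructor differBy
    field
      quotient : ℤ
      equality : z ≡ w ℤ.+ quotient ℤ.* ℤ.+ N

  ≈-reflexive : ∀ {z w} → z ≡ w → z ≈ w
  ≈-reflexive {z} refl = differBy 0ℤ $ lemma z (ℤ.+ N)
    where
    lemma : ∀ z n → z ≡ z ℤ.+ 0ℤ ℤ.* n
    lemma = solve-∀

  ≈-sym : ∀ {z w} → z ≈ w → w ≈ z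
  ≈-sym {w = w} (differBy q refl) = differBy (ℤ.- q) $ lemma w q (ℤ.+ N)
    where
    lemma : ∀ w q n → w ≡ w ℤ.+ q ℤ.* n ℤ.+ ℤ.- q ℤ.* n
    lemma = solve-∀

  ≈-trans : ∀ {z w v} → z ≈ w → w ≈ v → z ≈ v
  ≈-trans {v = v} (differBy q refl) (differBy r refl) = differBy (r ℤ.+ q) $ lemma v q r (ℤ.+ N)
    where
    lemma : ∀ v q r n → v ℤ.+ r ℤ.* n ℤ.+ q ℤ.* n ≡ v ℤ.+ (r ℤ.+ q) ℤ.* n
    lemma = solve-∀

  neg-cong : ∀ {z w} → z ≈ w → ℤ.- z ≈ ℤ.- w
  neg-cong {w = w} (differBy q refl) = differBy (ℤ.- q) $ lemma w q (ℤ.+ N)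
    where
    lemma : ∀ w q n → ℤ.- (w ℤ.+ q ℤ.* n) ≡ ℤ.- w ℤ.+ ℤ.- q ℤ.* n
    lemma = solve-∀

  +-cong : ∀ {z w z′ w′} → z ≈ w → z′ ≈ w′ → z ℤ.+ z′ ≈ w ℤ.+ w′
  +-cong {w = w} {w′ = w′} (differBy q refl) (differBy r refl) = differBy (q ℤ.+ r) $ lemma w w′ q r (ℤ.+ N)
    where
    lemma : ∀ w w′ q r n → w ℤ.+ q ℤ.* n ℤ.+ (w′ ℤ.+ r ℤ.* n) ≡ w ℤ.+ w′ ℤ.+ (q ℤ.+ r) ℤ.* n
    lemma = solve-∀

  -cong : ∀ {z w z′ w′} → z ≈ w → z′ ≈ w′ → z ℤ.- z′ ≈ w ℤ.- w′
  -cong z≈w z′≈w′ = +-cong z≈w (neg-cong z′≈w′)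

  -- The difference is a multiple of `N` of absolute value below `N`, so the quotient vanishes.
  ≈⇒≡ : ∀ {z w} → ∣ z ℤ.- w ∣ < N → z ≈ w → z ≡ w
  ≈⇒≡ {w = w} small (differBy q refl) = trans (cong (λ q → w ℤ.+ q ℤ.* ℤ.+ N) (q≡0 q ∣q∣N<N)) (lemma′ w (ℤ.+ N))
    where
    lemma : ∀ w q n → w ℤ.+ q ℤ.* n ℤ.- w ≡ q ℤ.* n
    lemma = solve-∀
    lemma′ : ∀ w n → w ℤ.+ 0ℤ ℤ.* n ≡ w
    lemma′ = solve-∀
    ∣q∣N<N : ∣ q ∣ * N < 1 * N
    ∣q∣N<N = subst₂ _<_ (trans (cong ∣_∣ (lemma w q (ℤ.+ N))) (ℤ.∣i*j∣≡∣i∣*∣j∣ q (ℤ.+ N))) (sym (*-identityˡ N)) small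
    q≡0 : ∀ q → ∣ q ∣ * N < 1 * N → q ≡ 0ℤ
    q≡0 q lt = ℤ.∣i∣≡0⇒i≡0 (n<1⇒n≡0 (*-cancelʳ-< N ∣ q ∣ 1 lt))

  small-≈⇒≡ : ∀ {s t} → ∣ s ∣ ≤ h → ∣ t ∣ ≤ h → s ≈ t → s ≡ t
  small-≈⇒≡ {s} {t} s≤h t≤h = ≈⇒≡ (begin-strict
    ∣ s ℤ.- t ∣     ≤⟨ ℤ.∣i-j∣≤∣i∣+∣j∣ s t ⟩
    ∣ s ∣ + ∣ t ∣   ≤⟨ +-mono-≤ s≤h t≤h ⟩
    h + h           ≡⟨ cong (h +_) (+-identityʳ h) ⟨
    2 * h           <⟨ n<1+n _ ⟩
    N               ∎)
    where open ≤-Reasoning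

  residue : ∀ z → z ≈ ℤ.+ (z ℤ.%ℕ N)
  residue z = differBy (z ℤ./ℕ N) $ ℤ.a≡a%ℕn+[a/ℕn]*n z N

  signedResidue : ∀ z → Σ[ s ∈ ℤ ] ∣ s ∣ ≤ h × z ≈ s
  signedResidue z with z ℤ.%ℕ N ≤? h
  ... | yes r≤h = ℤ.+ (z ℤ.%ℕ N) , r≤h , residue z
  ... | no  r≰h = r ℤ.⊖ N , bound , ≈-trans (residue z) (differBy ℤ.1ℤ eq)
    where
    r = z ℤ.%ℕ N
    bound : ∣ r ℤ.⊖ N ∣ ≤ h
    bound = begin
      ∣ r ℤ.⊖ N ∣ ≡⟨ ℤ.∣⊖∣-≤ (<⇒≤ (ℤ.n%ℕd<d z N)) ⟩
      -- Here `suc h ≤ r`, and `N ∸ suc h` computes to `2 * h ∸ h`.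
      N ∸ r       ≤⟨ ∸-monoʳ-≤ N (≰⇒> r≰h) ⟩
      2 * h ∸ h   ≡⟨ m+n∸m≡n h (h + 0) ⟩
      h + 0       ≡⟨ +-identityʳ h ⟩
      h           ∎
      where open ≤-Reasoning
    lemma : ∀ r n → r ≡ r ℤ.- n ℤ.+ ℤ.1ℤ ℤ.* n
    lemma = solve-∀
    eq : ℤ.+ r ≡ r ℤ.⊖ N ℤ.+ ℤ.1ℤ ℤ.* ℤ.+ N
    eq = trans (lemma (ℤ.+ r) (ℤ.+ N)) (cong (λ s → s ℤ.+ ℤ.1ℤ ℤ.* ℤ.+ N) (ℤ.m-n≡m⊖n r N))

  center : ℤ → ℤ
  center z = proj₁ (signedResidue z)

  ∣center∣≤h : ∀ z → ∣ center z ∣ ≤ h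
  ∣center∣≤h z = proj₁ (proj₂ (signedResidue z))

  ≈center : ∀ z → z ≈ center z
  ≈center z = proj₂ (proj₂ (signedResidue z))

  center-unique : ∀ {z s} → ∣ s ∣ ≤ h → z ≈ s → center z ≡ s
  center-unique {z} s≤h z≈s = small-≈⇒≡ (∣center∣≤h z) s≤h (≈-trans (≈-sym (≈center z)) z≈s)

  -- The window from `- h` to `h` is symmetric about `0`, so negation keeps representatives inside
  -- it.
  center-neg : ∀ {z w} → z ≈ ℤ.- w → center z ≡ ℤ.- center w
  center-neg {z} {w} z≈-w = center-unique
    (≤-trans (≤-reflexive (ℤ.∣-i∣≡∣i∣ (center w))) (∣center∣≤h w))
    (≈-trans z≈-w (neg-cong (≈center w)))

  ⟨_⟩ : Fin N → ℤ
  ⟨ i ⟩ = ℤ.+ toℕ i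

  index : ℤ → Fin N
  index z = fromℕ< (ℤ.n%ℕd<d z N)

  index≈ : ∀ z → ⟨ index z ⟩ ≈ z
  index≈ z = ≈-trans (≈-reflexive (cong ℤ.+_ (Fin.toℕ-fromℕ< (ℤ.n%ℕd<d z N)))) (≈-sym (residue z))

  ⟨⟩-injective : ∀ {i j} → ⟨ i ⟩ ≈ ⟨ j ⟩ → i ≡ j
  ⟨⟩-injective {i} {j} i≈j = Fin.toℕ-injective (ℤ.+-injective (≈⇒≡ small i≈j))
    where
    small : ∣ ⟨ i ⟩ ℤ.- ⟨ j ⟩ ∣ < N
    small = begin-strict
      ∣ ⟨ i ⟩ ℤ.- ⟨ j ⟩ ∣ ≡⟨ cong ∣_∣ (ℤ.m-n≡m⊖n (toℕ i) (toℕ j)) ⟩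
      ∣ toℕ i ℤ.⊖ toℕ j ∣ ≤⟨ ℤ.∣m⊝n∣≤m⊔n (toℕ i) (toℕ j) ⟩
      toℕ i ⊔ toℕ j       <⟨ ⊔-pres-<m (Fin.toℕ<n i) (Fin.toℕ<n j) ⟩
      N                   ∎
      where open ≤-Reasoning

  -- Cyclic offsets, reflections and midpoints.

  offset : Fin N → Fin N → ℤ
  offset m i = center (⟨ i ⟩ ℤ.- ⟨ m ⟩)

  offset≈ : ∀ m i → ⟨ i ⟩ ℤ.- ⟨ m ⟩ ≈ offset m i
  offset≈ m i = ≈center (⟨ i ⟩ ℤ.- ⟨ m ⟩)

  offset-injective : ∀ m {i j} → offset m i ≡ offset m j → i ≡ j
  offset-injective m {i} {j} eq = ⟨⟩-injective (subst₂ _≈_ (lemma ⟨ i ⟩ ⟨ m ⟩) (lemma ⟨ j ⟩ ⟨ m ⟩)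
    (+-cong (≈-trans (offset≈ m i) (≈-trans (≈-reflexive eq) (≈-sym (offset≈ m j)))) (≈-reflexive {⟨ m ⟩} refl)))
    where
    lemma : ∀ i m → i ℤ.- m ℤ.+ m ≡ i
    lemma = solve-∀

  offset-self : ∀ m → offset m m ≡ 0ℤ
  offset-self m = center-unique z≤n (≈-reflexive (ℤ.+-inverseʳ ⟨ m ⟩))

  reflect : Fin N → Fin N → Fin N → Fin N
  reflect i j m = index (⟨ i ⟩ ℤ.+ ⟨ j ⟩ ℤ.- ⟨ m ⟩)

  -- Because `i - (i + j - m)` is `m - j`.
  offset-reflect : ∀ i j m → offset (reflect i j m) i ≡ ℤ.- offset m j
  offset-reflect i j m = center-neg (≈-trans
    (-cong (≈-reflexive {⟨ i ⟩} refl) (index≈ (⟨ i ⟩ ℤ.+ ⟨ j ⟩ ℤ.- ⟨ m ⟩)))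
    (≈-reflexive (lemma ⟨ i ⟩ ⟨ j ⟩ ⟨ m ⟩)))
    where
    lemma : ∀ i j m → i ℤ.- (i ℤ.+ j ℤ.- m) ≡ ℤ.- (j ℤ.- m)
    lemma = solve-∀

  reflect-comm : ∀ i j m → reflect i j m ≡ reflect j i m
  reflect-comm i j m = cong (λ s → index (s ℤ.- ⟨ m ⟩)) (ℤ.+-comm ⟨ i ⟩ ⟨ j ⟩)

  offset-reflect′ : ∀ i j m → offset (reflect i j m) j ≡ ℤ.- offset m i
  offset-reflect′ i j m = trans (cong (λ m′ → offset m′ j) (reflect-comm i j m)) (offset-reflect j i m)

  reflect-involutive : ∀ i j m → reflect i j (reflect i j m) ≡ m
  reflect-involutive i j m = ⟨⟩-injective (≈-trans (index≈ _) (≈-trans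
    (-cong (≈-reflexive {⟨ i ⟩ ℤ.+ ⟨ j ⟩} refl) (index≈ (⟨ i ⟩ ℤ.+ ⟨ j ⟩ ℤ.- ⟨ m ⟩)))
    (≈-reflexive (i-[i-m]≡m (⟨ i ⟩ ℤ.+ ⟨ j ⟩) ⟨ m ⟩))))

  reflection : Fin N → Fin N → Permutation′ N
  reflection i j = involution⇒permutation (reflect i j) (reflect-involutive i j)

  -- N is odd, so i + j can be halved: 1 + h is the inverse of 2 modulo N.
  midpoint : Fin N → Fin N → Fin N
  midpoint i j = index ((⟨ i ⟩ ℤ.+ ⟨ j ⟩) ℤ.* (ℤ.1ℤ ℤ.+ ℤ.+ h))

  offset-midpoint : ∀ i j → offset (midpoint i j) i ≡ ℤ.- offset (midpoint i j) j
  offset-midpoint i j = center-neg (≈-trans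
    (-cong (≈-reflexive {⟨ i ⟩} refl) mid)
    (≈-trans (differBy q eq) (neg-cong (-cong (≈-reflexive {⟨ j ⟩} refl) (≈-sym mid)))))
    where
    mid = index≈ ((⟨ i ⟩ ℤ.+ ⟨ j ⟩) ℤ.* (ℤ.1ℤ ℤ.+ ℤ.+ h))
    -- The two sides differ by `i + j` minus twice the midpoint; as `2 * (1 + h)` is `N + 1`, this
    -- leaves `- (i + j)` times `N`.
    q = ℤ.- (⟨ i ⟩ ℤ.+ ⟨ j ⟩)
    lemma : ∀ i j h → i ℤ.- (i ℤ.+ j) ℤ.* (ℤ.1ℤ ℤ.+ h) ≡
      ℤ.- (j ℤ.- (i ℤ.+ j) ℤ.* (ℤ.1ℤ ℤ.+ h)) ℤ.+ ℤ.- (i ℤ.+ j) ℤ.* (ℤ.1ℤ ℤ.+ ℤ.+ 2 ℤ.* h)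
    lemma = solve-∀
    eq : ⟨ i ⟩ ℤ.- (⟨ i ⟩ ℤ.+ ⟨ j ⟩) ℤ.* (ℤ.1ℤ ℤ.+ ℤ.+ h) ≡
      ℤ.- (⟨ j ⟩ ℤ.- (⟨ i ⟩ ℤ.+ ⟨ j ⟩) ℤ.* (ℤ.1ℤ ℤ.+ ℤ.+ h)) ℤ.+ q ℤ.* ℤ.+ N
    eq = trans (lemma ⟨ i ⟩ ⟨ j ⟩ (ℤ.+ h)) (cong (λ n → ℤ.- (⟨ j ⟩ ℤ.- (⟨ i ⟩ ℤ.+ ⟨ j ⟩) ℤ.* (ℤ.1ℤ ℤ.+ ℤ.+ h)) ℤ.+ q ℤ.* (ℤ.1ℤ ℤ.+ n)) (sym (ℤ.pos-* 2 h)))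

  -- Reflection swaps the offsets of `i` and `j` up to sign, so both sides have the same two
  -- summands. A general even `r` covers plain distances and also `spread`.
  reflection-balances : (r : ℤ → ℕ) → (∀ s → r (ℤ.- s) ≡ r s) → ∀ i j m →
    r (offset (reflect i j m) i) + r (offset m i) ≡ r (offset (reflect i j m) j) + r (offset m j)
  reflection-balances r r-even i j m = begin
    r (offset (reflect i j m) i) + r (offset m i) ≡⟨ cong (λ s → r s + r (offset m i)) (offset-reflect i j m) ⟩
    r (ℤ.- offset m j) + r (offset m i)           ≡⟨ cong₂ _+_ (r-even (offset m j)) (sym (r-even (offset m i))) ⟩
    r (offset m j) + r (ℤ.- offset m i)           ≡⟨ +-comm (r (offset m j)) _ ⟩
    r (ℤ.- offset m i) + r (offset m j)           ≡⟨ cong (λ s → r s + r (offset m j)) (offset-reflect′ i j m) ⟨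
    r (offset (reflect i j m) j) + r (offset m j) ∎
    where open ≡-Reasoning

  midpoint-ties : (r : ℤ → ℕ) → (∀ s → r (ℤ.- s) ≡ r s) → ∀ i j →
    r (offset (midpoint i j) i) ≡ r (offset (midpoint i j) j)
  midpoint-ties r r-even i j = trans (cong r (offset-midpoint i j)) (r-even (offset (midpoint i j) j))

  oddLayout : Layout N N
  oddLayout = record
    { pos        = offset
    ; pos-inj    = offset-injective
    ; bound      = h
    ; rank≤bound = λ m i → ∣center∣≤h (⟨ i ⟩ ℤ.- ⟨ m ⟩)
    ; balanced   = λ {i} {j} _ → reflection i j
        , reflection-balances ∣_∣ ℤ.∣-i∣≡∣i∣ i j
        , midpoint i j
        , midpoint-ties ∣_∣ ℤ.∣-i∣≡∣i∣ i j
    }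

-- An extra die when the number of sides is `1 + 4 * q`.

module ExtraDie (q : ℕ) where

  h : ℕ
  h = 2 * q

  open Cyclic h

  -- Exchanges the distances d and h + 1 - d, keeping the side and fixing 0.
  mirror : ℤ → ℤ
  mirror (ℤ.+ zero)  = ℤ.+ zero
  mirror ℤ.+[1+ d ]  = ℤ.+[1+ h ∸ suc d ]
  mirror ℤ.-[1+ d ]  = ℤ.-[1+ h ∸ suc d ]

  suc[h∸suc] : ∀ {d} → d < h → suc (h ∸ suc d) ≡ h ∸ d
  suc[h∸suc] d<h = sym (+-∸-assoc 1 d<h)

  h∸suc-involutive : ∀ {d} → d < h → h ∸ suc (h ∸ suc d) ≡ d
  h∸suc-involutive d<h = trans (cong (h ∸_) (suc[h∸suc] d<h)) (m∸[m∸n]≡n (<⇒≤ d<h))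

  mirror-involutive : ∀ s → ∣ s ∣ ≤ h → mirror (mirror s) ≡ s
  mirror-involutive (ℤ.+ zero) _   = refl
  mirror-involutive ℤ.+[1+ d ] d<h = cong ℤ.+[1+_] (h∸suc-involutive d<h)
  mirror-involutive ℤ.-[1+ d ] d<h = cong ℤ.-[1+_] (h∸suc-involutive d<h)

  ∣mirror∣≤h : ∀ s → ∣ s ∣ ≤ h → ∣ mirror s ∣ ≤ h
  ∣mirror∣≤h (ℤ.+ zero) _   = z≤n
  ∣mirror∣≤h ℤ.+[1+ d ] d<h = ≤-trans (≤-reflexive (suc[h∸suc] d<h)) (m∸n≤m h d)
  ∣mirror∣≤h ℤ.-[1+ d ] d<h = ≤-trans (≤-reflexive (suc[h∸suc] d<h)) (m∸n≤m h d)

  -- Die `i` has offset `s` in block `i - s`; here `s` is the mirrored offset.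
  mirrorAt : Fin N → Fin N → Fin N
  mirrorAt i m = index (⟨ i ⟩ ℤ.- mirror (offset m i))

  offset-mirrorAt : ∀ i m → offset (mirrorAt i m) i ≡ mirror (offset m i)
  offset-mirrorAt i m = center-unique (∣mirror∣≤h (offset m i) (∣center∣≤h (⟨ i ⟩ ℤ.- ⟨ m ⟩)))
    (≈-trans (-cong (≈-reflexive {⟨ i ⟩} refl) (index≈ (⟨ i ⟩ ℤ.- mirror (offset m i))))
      (≈-reflexive (i-[i-m]≡m ⟨ i ⟩ (mirror (offset m i)))))

  mirrorAt-involutive : ∀ i m → mirrorAt i (mirrorAt i m) ≡ m
  mirrorAt-involutive i m = ⟨⟩-injective (≈-trans (index≈ (⟨ i ⟩ ℤ.- mirror (offset (mirrorAt i m) i)))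
    (≈-trans (-cong (≈-reflexive {⟨ i ⟩} refl) (≈-trans (≈-reflexive
        (trans (cong mirror (offset-mirrorAt i m)) (mirror-involutive (offset m i) (∣center∣≤h (⟨ i ⟩ ℤ.- ⟨ m ⟩)))))
        (≈-sym (offset≈ m i))))
      (≈-reflexive (i-[i-m]≡m ⟨ i ⟩ ⟨ m ⟩))))

  -- Moves the centre to height h + 1, which separates the low distances from
  -- the high ones; as h is even, no doubled distance hits it.
  spread : ℤ → ℤ
  spread (ℤ.+ zero) = ℤ.+ suc h
  spread ℤ.+[1+ d ] = ℤ.+ (2 * suc d)
  spread ℤ.-[1+ d ] = ℤ.- (ℤ.+ (2 * suc d))

  -- `h` is `2 * q`, so `suc h` is odd; this is where the shape `1 + 4 * q` of `N` enters.
  2*≢suc-h : ∀ d → 2 * d ≢ suc h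
  2*≢suc-h d = even≢odd d q

  spread-injective : ∀ s t → spread s ≡ spread t → s ≡ t
  spread-injective (ℤ.+ zero) (ℤ.+ zero) eq = refl
  spread-injective (ℤ.+ zero) ℤ.+[1+ e ] eq = contradiction (sym (ℤ.+-injective eq)) (2*≢suc-h (suc e))
  spread-injective ℤ.+[1+ d ] (ℤ.+ zero) eq = contradiction (ℤ.+-injective eq) (2*≢suc-h (suc d))
  spread-injective ℤ.+[1+ d ] ℤ.+[1+ e ] eq = cong ℤ.+_ (*-cancelˡ-≡ (suc d) (suc e) 2 (ℤ.+-injective eq))
  spread-injective (ℤ.+ zero) ℤ.-[1+ e ] ()
  spread-injective ℤ.+[1+ d ] ℤ.-[1+ e ] ()
  spread-injective ℤ.-[1+ d ] (ℤ.+ zero) ()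
  spread-injective ℤ.-[1+ d ] ℤ.+[1+ e ] ()
  spread-injective ℤ.-[1+ d ] ℤ.-[1+ e ] eq =
    cong (λ d → ℤ.- ℤ.+ d) (*-cancelˡ-≡ (suc d) (suc e) 2 (ℤ.+-injective (ℤ.neg-injective eq)))

  ∣spread-neg∣ : ∀ s → ∣ spread (ℤ.- s) ∣ ≡ ∣ spread s ∣
  ∣spread-neg∣ (ℤ.+ zero) = refl
  ∣spread-neg∣ ℤ.+[1+ d ] = refl
  ∣spread-neg∣ ℤ.-[1+ d ] = refl

  ∣spread∣≤ : ∀ s → ∣ s ∣ ≤ h → ∣ spread s ∣ ≤ 2 * suc h
  ∣spread∣≤ (ℤ.+ zero) _   = m≤n*m (suc h) 2
  ∣spread∣≤ ℤ.+[1+ d ] d<h = *-monoʳ-≤ 2 (m≤n⇒m≤1+n d<h)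
  ∣spread∣≤ ℤ.-[1+ d ] d<h = *-monoʳ-≤ 2 (m≤n⇒m≤1+n d<h)

  2*suc-sum : ∀ {d} → d < h → 2 * suc (h ∸ suc d) + 2 * suc d ≡ suc h + suc h
  2*suc-sum {d} d<h = begin
    2 * suc (h ∸ suc d) + 2 * suc d ≡⟨ *-distribˡ-+ 2 (suc (h ∸ suc d)) (suc d) ⟨
    2 * suc (h ∸ suc d + suc d)     ≡⟨ cong (λ x → 2 * suc x) (m∸n+n≡m d<h) ⟩
    2 * suc h                       ≡⟨ cong (suc h +_) (+-identityʳ (suc h)) ⟩
    suc h + suc h                   ∎
    where open ≡-Reasoning

  -- Distances `d` and `h + 1 - d` double to heights with sum `2 * (h + 1)`; the fixed centre counts
  -- `h + 1` twice.
  ∣spread-mirror∣ : ∀ s → ∣ s ∣ ≤ h → ∣ spread (mirror s) ∣ + ∣ spread s ∣ ≡ suc h + suc h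
  ∣spread-mirror∣ (ℤ.+ zero) _   = refl
  ∣spread-mirror∣ ℤ.+[1+ d ] d<h = 2*suc-sum d<h
  ∣spread-mirror∣ ℤ.-[1+ d ] d<h = 2*suc-sum d<h

  position : Fin N → Fin (suc N) → ℤ
  -- The negative of the centre's position: the same height, but still a different position.
  position m zero    = ℤ.-[1+ h ]
  position m (suc i) = spread (offset m i)

  extra≢spread : ∀ s → ℤ.-[1+ h ] ≢ spread s
  extra≢spread (ℤ.+ zero) ()
  extra≢spread ℤ.+[1+ d ] ()
  extra≢spread ℤ.-[1+ d ] eq = 2*≢suc-h (suc d) (sym (cong ∣_∣ eq))

  position-injective : ∀ m {i j} → position m i ≡ position m j → i ≡ j
  position-injective m {zero}  {zero}  eq = refl
  position-injective m {zero}  {suc j} eq = contradiction eq (extra≢spread (offset m j))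
  position-injective m {suc i} {zero}  eq = contradiction (sym eq) (extra≢spread (offset m i))
  position-injective m {suc i} {suc j} eq =
    cong suc (offset-injective m (spread-injective (offset m i) (offset m j) eq))

  rank : Fin N → Fin (suc N) → ℕ
  rank m i = ∣ position m i ∣

  ∣position∣≤ : ∀ m i → rank m i ≤ 2 * suc h
  ∣position∣≤ m zero    = m≤n*m (suc h) 2
  ∣position∣≤ m (suc i) = ∣spread∣≤ (offset m i) (∣center∣≤h (⟨ i ⟩ ℤ.- ⟨ m ⟩))

  -- The extra die has rank `suc h` in every block, so two blocks give it `suc h + suc h`, as a
  -- block and its mirror image give the other die. They tie in block `i`, where the offset is `0`.
  balanced-extra : ∀ i → Balanced rank (suc i) zero
  balanced-extra i = involution⇒permutation (mirrorAt i) (mirrorAt-involutive i)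
    , (λ m → trans (cong (λ s → ∣ spread s ∣ + rank m (suc i)) (offset-mirrorAt i m))
        (∣spread-mirror∣ (offset m i) (∣center∣≤h (⟨ i ⟩ ℤ.- ⟨ m ⟩))))
    , i , cong (∣_∣ ∘ spread) (offset-self i)

  balanced : ∀ {i j} → i ≢ j → Balanced rank i j
  balanced {zero}  {zero}  i≢j = contradiction refl i≢j
  balanced {zero}  {suc j} _   = Balanced-sym rank {suc j} {zero} (balanced-extra j)
  balanced {suc i} {zero}  _   = balanced-extra i
  balanced {suc i} {suc j} _   = reflection i j
    , reflection-balances (∣_∣ ∘ spread) ∣spread-neg∣ i j
    , midpoint i j
    , midpoint-ties (∣_∣ ∘ spread) ∣spread-neg∣ i j

  extraLayout : Layout N (suc N)
  extraLayout = record
    { pos        = position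
    ; pos-inj    = position-injective
    ; bound      = 2 * suc h
    ; rank≤bound = ∣position∣≤
    ; balanced   = balanced
    }

-- The three cases of the theorem.

even-or-odd : ∀ n → ∃[ h ] (n ≡ 2 * h ⊎ n ≡ suc (2 * h))
even-or-odd zero    = zero , inj₁ refl
even-or-odd (suc n) with even-or-odd n
... | h , inj₁ n≡2h   = h , inj₂ (cong suc n≡2h)
... | h , inj₂ n≡1+2h = suc h , inj₁ (trans (cong suc n≡1+2h) (sym (*-suc 2 h)))

theorem3 : (n : ℕ) (T : Tournament n) →
    (¬ (2 ∣ n) → RealizableWithSides T n) ×
    (4 ∣ n → RealizableWithSides T (n + 1)) ×
    (2 ∣ n → ¬ (4 ∣ n) → RealizableWithSides T (n ∸ 1))
theorem3 n T = odd n T , fourfold n T , even n T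
  where
  odd : ∀ n (T : Tournament n) → ¬ (2 ∣ n) → RealizableWithSides T n
  odd n T 2∤n with even-or-odd n
  ... | h , inj₁ n≡2h = contradiction (divides h (trans n≡2h (*-comm 2 h))) 2∤n
  ... | h , inj₂ refl = layout⇒realizable T (Cyclic.oddLayout h)

  fourfold : ∀ n (T : Tournament n) → 4 ∣ n → RealizableWithSides T (n + 1)
  fourfold n T (divides t n≡4t) = subst (RealizableWithSides T) (sym n+1≡N)
    (layout⇒realizable T (restrict (λ i → Fin.inject≤ i n≤N) (Fin.inject≤-injective n≤N n≤N _ _) (Cyclic.oddLayout (2 * t))))
    where
    n+1≡N : n + 1 ≡ suc (2 * (2 * t))
    n+1≡N = trans (+-comm n 1) (cong suc (trans n≡4t (trans (*-comm t 4) (*-assoc 2 2 t))))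
    n≤N : n ≤ suc (2 * (2 * t))
    n≤N = ≤-trans (m≤m+n n 1) (≤-reflexive n+1≡N)

  even : ∀ n (T : Tournament n) → 2 ∣ n → ¬ (4 ∣ n) → RealizableWithSides T (n ∸ 1)
  even n T (divides t n≡t2) 4∤n with even-or-odd t
  ... | q , inj₁ refl = contradiction (divides q (trans n≡t2 (trans (cong (_* 2) (*-comm 2 q)) (*-assoc q 2 2)))) 4∤n
  ... | q , inj₂ refl with trans n≡t2 (*-comm (suc (2 * q)) 2)
  -- With `n` in the form `2 + 2 * (2 * q)`, it is `suc N` for `h = 2 * q`, and `n ∸ 1` computes to
  -- `N`.
  ...   | n≡ with trans n≡ (*-suc 2 (2 * q))
  ...     | refl = layout⇒realizable T (ExtraDie.extraLayout q)
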